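{- Let $a,b\in\mathbb N$ and let $n$ be a positive integer. For each $a'\in\{a,a-1\}$, $$\sum_{k=0}^{n-1}(-1)^{a'k}q^{a'k(k+1)/2-k}[2k+1]_q\begin{bmatrix}n-1\\k\end{bmatrix}_q^a\begin{bmatrix}n+k\\k\end{bmatrix}_q^b\equiv0\pmod{[n]_q}$$ (in the Laurent polynomial ring $\mathbb Z[q,q^{ -1}]$). Consequently, for either choice of sign, $$\sum_{k=0}^{n-1}(\pm1)^k(2k+1)\binom{n-1}k^a\binom{n+k}k^b\equiv0\pmod n.$$
   Context: $[m]_q=(1-q^m)/(1-q)$ for $m\in\mathbb Z$; $\begin{bmatrix}m\\0\end{bmatrix}_q=1$ and $\begin{bmatrix}m\\k\end{bmatrix}_q=\prod_{j=0}^{k-1}[m-j]_q/\prod_{j=1}^k[j]_q$ for $k\ge1$. -}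

module Defs where

open import Data.Nat as ℕ using (ℕ; zero; suc)
open import Data.Nat.DivMod using (_/_)
open import Data.Nat.Combinatorics using (_C_)
open import Data.Integer as ℤ using (ℤ; +_; -[1+_])
open import Data.Integer.Divisibility as ℤD using ()
open import Data.List using (List; []; _∷_; replicate; map)
open import Data.Product using (Σ)
open import Relation.Binary.PropositionalEquality using (_≡_)

-- Polynomial coefficient lists over ℤ (index j = coefficient of q^j)

addL : List ℤ → List ℤ → List ℤ
addL [] ys = ys
addL xs [] = xs
addL (x ∷ xs) (y ∷ ys) = (x ℤ.+ y) ∷ addL xs ys

mulL : List ℤ → List ℤ → List ℤ
mulL [] ys = []
mulL (x ∷ xs) ys = addL (map (x ℤ.*_) ys) (+ 0 ∷ mulL xs ys)

lookupL : List ℤ → ℕ → ℤ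
lookupL [] _ = + 0
lookupL (x ∷ xs) zero = x
lookupL (x ∷ xs) (suc j) = lookupL xs j

-- Laurent polynomials in ℤ[q,q⁻¹]:  lo , [c₀,c₁,…]  represents  Σ_j c_j q^(lo+j)

record Laurent : Set where
  constructor laurent
  field
    lo : ℤ
    cs : List ℤ
open Laurent public

coeff : Laurent → ℤ → ℤ
coeff p i with i ℤ.- lo p
... | + j = lookupL (cs p) j
... | -[1+ _ ] = + 0

padL : ℕ → List ℤ → List ℤ
padL d xs = replicate d (+ 0) Data.List.++ xs
  where import Data.List

_+L_ : Laurent → Laurent → Laurent
p +L r = laurent m (addL (padL ℤ.∣ lo p ℤ.- m ∣ (cs p)) (padL ℤ.∣ lo r ℤ.- m ∣ (cs r)))
  where m = lo p ℤ.⊓ lo r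

_*L_ : Laurent → Laurent → Laurent
p *L r = laurent (lo p ℤ.+ lo r) (mulL (cs p) (cs r))

infixl 6 _+L_
infixl 7 _*L_

mono : ℤ → ℤ → Laurent
mono c e = laurent e (c ∷ [])

zeroL oneL : Laurent
zeroL = laurent (+ 0) []
oneL = mono (+ 1) (+ 0)

_^L_ : Laurent → ℕ → Laurent
p ^L zero = oneL
p ^L suc m = p *L (p ^L m)

sumL : ℕ → (ℕ → Laurent) → Laurent
sumL zero f = zeroL
sumL (suc m) f = sumL m f +L f m

_∣L_ : Laurent → Laurent → Set
d ∣L p = Σ Laurent (λ g → ∀ (i : ℤ) → coeff p i ≡ coeff (d *L g) i)

-- [m]_q = (1 - q^m)/(1 - q) = 1 + q + ⋯ + q^(m-1)
qint : ℕ → Laurent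
qint m = laurent (+ 0) (replicate m (+ 1))

-- Gaussian binomial [m choose k]_q for m, k ∈ ℕ, via the q-Pascal rule
qbinom : ℕ → ℕ → Laurent
qbinom m zero = oneL
qbinom zero (suc k) = zeroL
qbinom (suc m) (suc k) = qbinom m k +L mono (+ 1) (+ suc k) *L qbinom m (suc k)

tri : ℕ → ℕ
tri k = (k ℕ.* suc k) / 2

qterm : ℤ → ℕ → ℕ → ℕ → ℕ → Laurent
qterm a' a b n k =
  mono (ℤ.-1ℤ ℤ.^ (ℤ.∣ a' ∣ ℕ.* k)) (a' ℤ.* (+ tri k) ℤ.- (+ k))
    *L qint (2 ℕ.* k ℕ.+ 1)
    *L (qbinom (n ℕ.∸ 1) k ^L a)
    *L (qbinom (n ℕ.+ k) k ^L b)

qsum : ℤ → ℕ → ℕ → ℕ → Laurent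
qsum a' a b n = sumL n (qterm a' a b n)

sumℤ : ℕ → (ℕ → ℤ) → ℤ
sumℤ zero f = + 0
sumℤ (suc m) f = sumℤ m f ℤ.+ f m

isum : ℤ → ℕ → ℕ → ℕ → ℤ
isum s a b n = sumℤ n (λ k →
  (s ℤ.^ k) ℤ.* (+ (2 ℕ.* k ℕ.+ 1))
    ℤ.* (+ (((n ℕ.∸ 1) C k) ℕ.^ a))
    ℤ.* (+ (((n ℕ.+ k) C k) ℕ.^ b)))

{-# OPTIONS --safe #-}
module Submission where

open import Defs
open import Algebra.Bundles using (CommutativeRing; CommutativeSemiring)
open import Algebra.Structures.Biased using (isCommutativeSemiringʳ)
open import Data.Nat as ℕ using (ℕ; zero; suc; _≤_)
import Data.Nat.Properties as ℕ
open import Data.Nat.Combinatorics using (_C_; k>n⇒nCk≡0; nCk+nC[k+1]≡[n+1]C[k+1])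
open import Data.Nat.DivMod using (_/_; +-distrib-/-∣ʳ; m*n/n≡m)
import Data.Nat.Divisibility as ℕ using (divides)
open import Data.Nat.Tactic.RingSolver using () renaming (solve-∀ to ℕ-solve-∀)
open import Data.Integer as ℤ using (ℤ; +_; -[1+_]; _-_; -1ℤ)
import Data.Integer.Properties as ℤ
open import Data.Integer.Divisibility using (_∣_)
open import Data.Integer.Divisibility.Signed using (divides; ∣⇒∣ᵤ)
open import Data.Integer.Tactic.RingSolver using (solve-∀)
open import Data.List.Base using (List; []; _∷_; map)
open import Data.Product using (_×_; _,_; Σ; proj₁; proj₂)
open import Data.Sum using (_⊎_; inj₁; inj₂)
open import Function.Base using (_∘_)
open import Level using (_⊔_)
open import Relation.Binary.PropositionalEquality as ≡ using (_≡_; cong; cong₂)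
open import Relation.Binary.Structures using (IsEquivalence)

-- Let X_k = (-1)^k q^(k(k+1)/2) [n-1,k] and Y_k = [n+k,k].  By the q-Pascal rule X_k - X_(k+1) is a
-- unit times [n,k+1], and Y_(k+1) - Y_k is a unit times [n+k,k+1]; since [k+1][n,k+1] = [n][n-1,k] and
-- [k+1][n+k,k+1] = [n][n+k,k], the product [k+1] X_k^a Y_k^b is unchanged modulo [n] when k is
-- replaced by k+1.  The remaining weights w_k telescope, w_k = V_(k+1) [k+1] - V_k [k], so Abel
-- summation gives sum_{k<n} w_k X_k^a Y_k^b = V_n [n] X_n^a Y_n^b = 0 modulo [n].  The argument works
-- for any semiring with monomials c q^e, hence both for Laurent polynomials and, with q = 1, for ℤ.

-- Triangular exponents and semirings with monomials.

tri-suc : ∀ k → tri (suc k) ≡ tri k ℕ.+ suc k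
tri-suc k = ≡.trans (cong (_/ 2) (split k))
  -- The floor of the sum splits because the summand `suc k ℕ.* 2` is an exact multiple of 2.
  (≡.trans (+-distrib-/-∣ʳ (k ℕ.* suc k) (ℕ.divides (suc k) ≡.refl)) (cong (tri k ℕ.+_) (m*n/n≡m (suc k) 2)))
  where
  split : ∀ k → suc k ℕ.* suc (suc k) ≡ k ℕ.* suc k ℕ.+ suc k ℕ.* 2
  split = ℕ-solve-∀

-- Negatives enter only as monomials with coefficient -1, and `qmono+neg` is the cancellation law
-- that replaces subtraction.
record QMonomials {ℓ₁ ℓ₂} (R : CommutativeSemiring ℓ₁ ℓ₂) : Set (ℓ₁ ⊔ ℓ₂) where
  open CommutativeSemiring R hiding (zero)
  field
    qmono     : ℤ → ℤ → Carrier
    qmono-1   : qmono (+ 1) (+ 0) ≈ 1#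
    qmono-*   : ∀ c e d f → qmono c e * qmono d f ≈ qmono (c ℤ.* d) (e ℤ.+ f)
    qmono+neg : ∀ e → qmono (+ 1) e + qmono -1ℤ e ≈ 0#

module QSums {ℓ₁ ℓ₂} (R : CommutativeSemiring ℓ₁ ℓ₂) (M : QMonomials R) where

  open CommutativeSemiring R hiding (zero)
  open QMonomials M
  open import Algebra.Properties.Semiring.Exp semiring public using (_^_)
  open import Algebra.Properties.CommutativeSemiring.Exp R using (^-distrib-*)
  open import Algebra.Solver.Ring.NaturalCoefficients.Default R using (solve; _:=_; _:+_; _:*_; con)
  open import Relation.Binary.Reasoning.Setoid setoid

  -- q-integers and Gaussian binomials.

  qmono-cong : ∀ {c d e f} → c ≡ d → e ≡ f → qmono c e ≈ qmono d f
  qmono-cong c≡d e≡f = reflexive (cong₂ qmono c≡d e≡f)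

  Q : ℤ → Carrier
  Q = qmono (+ 1)

  Q-* : ∀ e f → Q (e ℤ.+ f) ≈ Q e * Q f
  Q-* e f = sym (qmono-* (+ 1) e (+ 1) f)

  [_] : ℕ → Carrier
  [ zero ]  = 0#
  [ suc m ] = 1# + Q (+ 1) * [ m ]

  [_choose_] : ℕ → ℕ → Carrier
  [ m choose zero ]      = 1#
  [ zero choose suc k ]  = 0#
  [ suc m choose suc k ] = [ m choose k ] + Q (+ suc k) * [ m choose suc k ]

  ∑ : ℕ → (ℕ → Carrier) → Carrier
  ∑ zero    f = 0#
  ∑ (suc m) f = ∑ m f + f m

  ∑-cong : ∀ m {f g} → (∀ k → f k ≈ g k) → ∑ m f ≈ ∑ m g
  ∑-cong zero    f≈g = refl
  ∑-cong (suc m) f≈g = +-cong (∑-cong m f≈g) (f≈g m)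

  qint-+ : ∀ m k → [ m ℕ.+ k ] ≈ [ m ] + Q (+ m) * [ k ]
  qint-+ zero    k = trans (solve 1 (λ x → x := con 0 :+ con 1 :* x) refl [ k ])
                           (+-congˡ (*-congʳ (sym qmono-1)))
  qint-+ (suc m) k = begin
    1# + Q (+ 1) * [ m ℕ.+ k ]               ≈⟨ +-congˡ (*-congˡ (qint-+ m k)) ⟩
    1# + Q (+ 1) * ([ m ] + Q (+ m) * [ k ]) ≈⟨ rearrange (Q (+ 1)) [ m ] (Q (+ m)) [ k ] ⟩
    [ suc m ] + (Q (+ 1) * Q (+ m)) * [ k ]  ≈⟨ +-congˡ (*-congʳ (sym (Q-* (+ 1) (+ m)))) ⟩
    [ suc m ] + Q (+ suc m) * [ k ]          ∎
    where
    rearrange = solve 4 (λ q x r y → con 1 :+ q :* (x :+ r :* y) := con 1 :+ q :* x :+ (q :* r) :* y) refl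

  qint-suc′ : ∀ k → [ suc k ] ≈ [ k ] + Q (+ k)
  qint-suc′ k = begin
    [ suc k ]                             ≈⟨ reflexive (cong [_] (ℕ.+-comm 1 k)) ⟩
    [ k ℕ.+ 1 ]                           ≈⟨ qint-+ k 1 ⟩
    [ k ] + Q (+ k) * (1# + Q (+ 1) * 0#) ≈⟨ simplify [ k ] (Q (+ k)) (Q (+ 1)) ⟩
    [ k ] + Q (+ k)                       ∎
    where
    simplify = solve 3 (λ x r q → x :+ r :* (con 1 :+ q :* con 0) := x :+ r) refl

  qint-odd : ∀ k → [ 2 ℕ.* k ℕ.+ 1 ] ≈ [ suc k ] + Q (+ suc k) * [ k ]
  qint-odd k = trans (reflexive (cong [_] (split k))) (qint-+ (suc k) k)
    where
    split : ∀ k → 2 ℕ.* k ℕ.+ 1 ≡ suc k ℕ.+ k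
    split = ℕ-solve-∀

  -- Induction on the upper index. After q-Pascal, `[ 2 ℕ.+ k ]` is opened as 1 + q[k+1] on the
  -- first summand only, so the induction hypothesis applies at `k` there and at `suc k` on the
  -- second summand.
  qbinom-absorb : ∀ m k → [ suc k ] * [ suc m choose suc k ] ≈ [ suc m ] * [ m choose k ]
  qbinom-absorb zero zero = solve 2 (λ x q → x :* (con 1 :+ q :* con 0) := x :* con 1) refl [ 1 ] (Q (+ 1))
  qbinom-absorb zero (suc k) =
    solve 3 (λ x y q → x :* (con 0 :+ q :* con 0) := y :* con 0) refl [ 2 ℕ.+ k ] [ 1 ] (Q (+ suc (suc k)))
  qbinom-absorb (suc m) zero = begin
    [ 1 ] * (1# + Q (+ 1) * [ suc m choose 1 ]) ≈⟨ expand (Q (+ 1)) [ suc m choose 1 ] ⟩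
    1# + Q (+ 1) * ([ 1 ] * [ suc m choose 1 ]) ≈⟨ +-congˡ (*-congˡ (qbinom-absorb m zero)) ⟩
    1# + Q (+ 1) * ([ suc m ] * 1#)             ≈⟨ contract (Q (+ 1)) [ suc m ] ⟩
    [ suc (suc m) ] * 1#                        ∎
    where
    expand   = solve 2 (λ q x → (con 1 :+ q :* con 0) :* (con 1 :+ q :* x)
                              := con 1 :+ q :* ((con 1 :+ q :* con 0) :* x)) refl
    contract = solve 2 (λ q x → con 1 :+ q :* (x :* con 1) := (con 1 :+ q :* x) :* con 1) refl
  qbinom-absorb (suc m) (suc k) = begin
    [ 2 ℕ.+ k ] * (A + r′ * B)               ≈⟨ expand [ 2 ℕ.+ k ] A r′ B ⟩
    [ 2 ℕ.+ k ] * A + r′ * ([ 2 ℕ.+ k ] * B) ≈⟨ +-congˡ (*-cong (Q-* (+ 1) (+ suc k)) (qbinom-absorb m (suc k))) ⟩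
    (1# + q * c) * A + (q * r) * (t * y)     ≈⟨ regroup q c A r (t * y) ⟩
    A + q * (c * A + r * (t * y))            ≈⟨ +-congˡ (*-congˡ (+-congʳ (qbinom-absorb m k))) ⟩
    A + q * (t * x + r * (t * y))            ≈⟨ contract q t x r y ⟩
    [ 2 ℕ.+ m ] * A                          ∎
    where
    q = Q (+ 1)
    r = Q (+ suc k)
    r′ = Q (+ suc (suc k))
    c = [ suc k ]
    t = [ suc m ]
    x = [ m choose k ]
    y = [ m choose suc k ]
    A = [ suc m choose suc k ]
    B = [ suc m choose suc (suc k) ]
    expand = solve 4 (λ n a r b → n :* (a :+ r :* b) := n :* a :+ r :* (n :* b)) refl
    regroup = solve 5 (λ q c a r z → (con 1 :+ q :* c) :* a :+ (q :* r) :* z := a :+ q :* (c :* a :+ r :* z)) refl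
    contract = solve 5 (λ q t x r y → (x :+ r :* y) :+ q :* (t :* x :+ r :* (t :* y))
                                    := (con 1 :+ q :* t) :* (x :+ r :* y)) refl

  -- In the step from k to k+1, `qbinom-absorb` turns the left side into [n+k+1] [n+k,k+1].
  -- Splitting [n+k+1] = [k+1] + q^(k+1) [n] leaves the case k plus a multiple of [n], and q-Pascal
  -- reassembles the two.
  qbinom-absorb′ : ∀ n k → [ suc k ] * [ n ℕ.+ k choose suc k ] ≈ [ n ] * [ n ℕ.+ k choose k ]
  qbinom-absorb′ zero    zero = trans (zeroʳ [ 1 ]) (sym (zeroˡ 1#))
  qbinom-absorb′ (suc n) zero rewrite ℕ.+-identityʳ n = qbinom-absorb n zero
  qbinom-absorb′ n (suc k) rewrite ℕ.+-suc n k = begin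
    [ 2 ℕ.+ k ] * [ suc (n ℕ.+ k) choose 2 ℕ.+ k ] ≈⟨ qbinom-absorb (n ℕ.+ k) (suc k) ⟩
    [ suc (n ℕ.+ k) ] * B                          ≈⟨ *-congʳ (trans (reflexive (cong ([_] ∘ suc) (ℕ.+-comm n k))) (qint-+ (suc k) n)) ⟩
    ([ suc k ] + r * [ n ]) * B                    ≈⟨ expand [ suc k ] r [ n ] B ⟩
    [ suc k ] * B + r * ([ n ] * B)                ≈⟨ +-congʳ (qbinom-absorb′ n k) ⟩
    [ n ] * A + r * ([ n ] * B)                    ≈⟨ contract [ n ] A r B ⟩
    [ n ] * (A + r * B)                            ∎
    where
    r = Q (+ suc k)
    A = [ n ℕ.+ k choose k ]
    B = [ n ℕ.+ k choose suc k ]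
    expand = solve 4 (λ c r n b → (c :+ r :* n) :* b := c :* b :+ r :* (n :* b)) refl
    contract = solve 4 (λ n a r b → n :* a :+ r :* (n :* b) := n :* (a :+ r :* b)) refl

  -- Congruences modulo an element and Abel summation.

  -- One-sided: without subtraction this relation is not symmetric.
  infix 4 _≡[_]_
  _≡[_]_ : Carrier → Carrier → Carrier → Set (ℓ₁ ⊔ ℓ₂)
  x ≡[ d ] y = Σ Carrier λ g → x ≈ y + d * g

  ≈⇒≡[] : ∀ {d x y} → x ≈ y → x ≡[ d ] y
  ≈⇒≡[] {d} {x} {y} x≈y = 0# , trans x≈y (solve 2 (λ y d → y := y :+ d :* con 0) refl y d)

  ≡[]-trans : ∀ {d x y z} → x ≡[ d ] y → y ≡[ d ] z → x ≡[ d ] z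
  ≡[]-trans {d} {x} {y} {z} (g , x≈) (h , y≈) = g + h , (begin
    x                 ≈⟨ x≈ ⟩
    y + d * g         ≈⟨ +-congʳ y≈ ⟩
    z + d * h + d * g ≈⟨ solve 4 (λ z d g h → z :+ d :* h :+ d :* g := z :+ d :* (g :+ h)) refl z d g h ⟩
    z + d * (g + h)   ∎)

  ≡[]-+ : ∀ {d x y} z → x ≡[ d ] y → x + z ≡[ d ] y + z
  ≡[]-+ {d} {x} {y} z (g , x≈) = g , trans (+-congʳ x≈)
    (solve 4 (λ y d g z → y :+ d :* g :+ z := y :+ z :+ d :* g) refl y d g z)

  ≡[]-* : ∀ {d x y} z → x ≡[ d ] y → z * x ≡[ d ] z * y
  ≡[]-* {d} {x} {y} z (g , x≈) = z * g , trans (*-congˡ x≈)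
    (solve 4 (λ y d g z → z :* (y :+ d :* g) := z :* y :+ d :* (z :* g)) refl y d g z)

  -- The factors are replaced one after the other, with the single `e` moved next to the one being
  -- replaced. Congruences known only after multiplication by `e` thus pass to products without any
  -- division by `e`.
  scaled-* : ∀ {d} e {x x′ y y′} → e * x ≡[ d ] e * x′ → e * y ≡[ d ] e * y′ →
             e * (x * y) ≡[ d ] e * (x′ * y′)
  scaled-* e {x} {x′} {y} {y′} p r =
    ≡[]-trans (≈⇒≡[] (solve 3 (λ e x y → e :* (x :* y) := y :* (e :* x)) refl e x y))
    (≡[]-trans (≡[]-* y p)
    (≡[]-trans (≈⇒≡[] (solve 3 (λ e x y → y :* (e :* x) := x :* (e :* y)) refl e x′ y))
    (≡[]-trans (≡[]-* x′ r)
    (≈⇒≡[] (solve 3 (λ e x y → x :* (e :* y) := e :* (x :* y)) refl e x′ y′)))))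

  scaled-^ : ∀ {d} e {x x′} a → e * x ≡[ d ] e * x′ → e * (x ^ a) ≡[ d ] e * (x′ ^ a)
  scaled-^ e zero    p = ≈⇒≡[] refl
  scaled-^ e (suc a) p = scaled-* e p (scaled-^ e a p)

  -- Induction on the length: `W m` and `w m` first combine into `W (suc m)`, the factor in whose
  -- presence `T m` may be traded for `T (suc m)`. The boundary term at 0 vanishes with `W 0`.
  abel-summation : ∀ {d} (W w T : ℕ → Carrier) → W 0 ≈ 0# → (∀ k → W (suc k) ≈ W k + w k) →
    (∀ k → W (suc k) * T k ≡[ d ] W (suc k) * T (suc k)) →
    ∀ m → ∑ m (λ k → w k * T k) ≡[ d ] W m * T m
  abel-summation W w T W0 W-suc step zero    = ≈⇒≡[] (sym (trans (*-congʳ W0) (zeroˡ (T 0))))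
  abel-summation W w T W0 W-suc step (suc m) =
    ≡[]-trans (≡[]-+ (w m * T m) (abel-summation W w T W0 W-suc step m))
    (≡[]-trans (≈⇒≡[] (sym (trans (*-congʳ (W-suc m))
      (solve 3 (λ x y z → (x :+ y) :* z := x :* z :+ y :* z) refl (W m) (w m) (T m)))))
    (step m))

  -- The sequences X and Y modulo the q-integer.

  σ : ℕ → ℤ
  σ k = -1ℤ ℤ.^ k

  X : ℕ → ℕ → Carrier
  X m k = qmono (σ k) (+ tri k) * [ m choose k ]

  Y : ℕ → ℕ → Carrier
  Y n k = [ n ℕ.+ k choose k ]

  -- The difference X_k - X_(k+1) is `s` times [m+1,k+1], and absorption turns [k+1] times it into
  -- [m+1] times the witness `s * x`.
  X-scaled-step : ∀ m k → [ suc k ] * X m k ≡[ [ suc m ] ] [ suc k ] * X m (suc k)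
  X-scaled-step m k = s * x , (begin
    c * (s * x)
      -- A zero `(r + r′) * y` is inserted: `r * y` completes the q-Pascal expansion of [m+1,k+1],
      -- while `s * r′` is the monomial of `X m (suc k)`.
      ≈⟨ pad c s x y (trans (*-congʳ (qmono+neg (+ suc k))) (zeroˡ y)) ⟩
    c * (s * x + s * ((r + r′) * y))
      ≈⟨ regroup c s x y r r′ ⟩
    c * ((s * r′) * y) + s * (c * (x + r * y))
      ≈⟨ +-cong (*-congˡ (*-congʳ sr′≈)) (*-congˡ (qbinom-absorb m k)) ⟩
    c * X m (suc k) + s * (t * x)
      ≈⟨ +-congˡ (solve 3 (λ s t x → s :* (t :* x) := t :* (s :* x)) refl s t x) ⟩
    c * X m (suc k) + t * (s * x) ∎)
    where
    c = [ suc k ]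
    t = [ suc m ]
    s = qmono (σ k) (+ tri k)
    r = Q (+ suc k)
    r′ = qmono -1ℤ (+ suc k)
    x = [ m choose k ]
    y = [ m choose suc k ]
    pad : ∀ c s x y {z} → z ≈ 0# → c * (s * x) ≈ c * (s * x + s * z)
    pad c s x y z≈0 = trans (solve 3 (λ c s x → c :* (s :* x) := c :* (s :* x :+ s :* con 0)) refl c s x)
      (*-congˡ (+-congˡ (*-congˡ (sym z≈0))))
    regroup = solve 6 (λ c s x y r r′ → c :* (s :* x :+ s :* ((r :+ r′) :* y))
                                      := c :* ((s :* r′) :* y) :+ s :* (c :* (x :+ r :* y))) refl
    sr′≈ : s * r′ ≈ qmono (σ (suc k)) (+ tri (suc k))
    sr′≈ = trans (qmono-* (σ k) (+ tri k) -1ℤ (+ suc k))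
      (qmono-cong (ℤ.*-comm (σ k) -1ℤ) (cong +_ (≡.sym (tri-suc k))))

  -- The rewrite lets `Y n (suc k)` unfold by q-Pascal to `x + r * y`. The difference Y_k - Y_(k+1)
  -- is then -q^(k+1) [n+k,k+1], whence the witness `r′ * x`.
  Y-scaled-step : ∀ n k → [ suc k ] * Y n k ≡[ [ n ] ] [ suc k ] * Y n (suc k)
  Y-scaled-step n k rewrite ℕ.+-suc n k = r′ * x , (begin
    c * x
      ≈⟨ solve 2 (λ c x → c :* x := c :* (x :+ con 0)) refl c x ⟩
    c * (x + 0#)
      ≈⟨ *-congˡ (+-congˡ (sym (trans (*-congʳ (qmono+neg (+ suc k))) (zeroˡ y)))) ⟩
    c * (x + (r + r′) * y)
      ≈⟨ solve 5 (λ c x y r r′ → c :* (x :+ (r :+ r′) :* y) := c :* (x :+ r :* y) :+ r′ :* (c :* y)) refl c x y r r′ ⟩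
    c * (x + r * y) + r′ * (c * y)
      ≈⟨ +-congˡ (*-congˡ (qbinom-absorb′ n k)) ⟩
    c * (x + r * y) + r′ * ([ n ] * x)
      ≈⟨ +-congˡ (solve 3 (λ s t x → s :* (t :* x) := t :* (s :* x)) refl r′ [ n ] x) ⟩
    c * (x + r * y) + [ n ] * (r′ * x) ∎)
    where
    c = [ suc k ]
    r = Q (+ suc k)
    r′ = qmono -1ℤ (+ suc k)
    x = [ n ℕ.+ k choose k ]
    y = [ n ℕ.+ k choose suc k ]

  -- Summands, weights and divisibility of the sum.

  qmono-^ : ∀ c e a → qmono c e ^ a ≈ qmono (c ℤ.^ a) (+ a ℤ.* e)
  qmono-^ c e zero    = sym qmono-1
  qmono-^ c e (suc a) = begin
    qmono c e * qmono c e ^ a               ≈⟨ *-congˡ (qmono-^ c e a) ⟩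
    qmono c e * qmono (c ℤ.^ a) (+ a ℤ.* e) ≈⟨ qmono-* c e (c ℤ.^ a) (+ a ℤ.* e) ⟩
    qmono (c ℤ.* c ℤ.^ a) (e ℤ.+ + a ℤ.* e) ≈⟨ qmono-cong ≡.refl (≡.sym (ℤ.suc-* (+ a) e)) ⟩
    qmono (c ℤ.* c ℤ.^ a) (+ suc a ℤ.* e)   ∎

  -- Here `m` is n - 1. The monomial is left free so that both choices of a' are covered.
  term : ℤ → ℤ → ℕ → ℕ → ℕ → ℕ → Carrier
  term c e a b m k =
    qmono c e * [ 2 ℕ.* k ℕ.+ 1 ] * [ m choose k ] ^ a * [ suc m ℕ.+ k choose k ] ^ b

  -- The a-th power of the monomial in X_k is split off from the monomial of the summand; what
  -- remains is the weight.
  term-regroup : ∀ c e a b m k →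
    term (c ℤ.* σ k ℤ.^ a) (e ℤ.+ + a ℤ.* + tri k) a b m k
      ≈ qmono c e * [ 2 ℕ.* k ℕ.+ 1 ] * (X m k ^ a * Y (suc m) k ^ b)
  term-regroup c e a b m k = begin
    qmono (c ℤ.* σ k ℤ.^ a) (e ℤ.+ + a ℤ.* + tri k) * o * B * y
      ≈⟨ *-congʳ (*-congʳ (*-congʳ (qmono-* c e (σ k ℤ.^ a) (+ a ℤ.* + tri k)))) ⟨
    qmono c e * qmono (σ k ℤ.^ a) (+ a ℤ.* + tri k) * o * B * y
      ≈⟨ *-congʳ (*-congʳ (*-congʳ (*-congˡ (qmono-^ (σ k) (+ tri k) a)))) ⟨
    qmono c e * qmono (σ k) (+ tri k) ^ a * o * B * y
      ≈⟨ reorder (qmono c e) (qmono (σ k) (+ tri k) ^ a) o B y ⟩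
    qmono c e * o * ((qmono (σ k) (+ tri k) ^ a * B) * y)
      ≈⟨ *-congˡ (*-congʳ (^-distrib-* (qmono (σ k) (+ tri k)) [ m choose k ] a)) ⟨
    qmono c e * o * (X m k ^ a * y) ∎
    where
    o = [ 2 ℕ.* k ℕ.+ 1 ]
    B = [ m choose k ] ^ a
    y = Y (suc m) k ^ b
    reorder = solve 5 (λ u s o x y → u :* s :* o :* x :* y := u :* o :* ((s :* x) :* y)) refl

  -- The hypothesis says that `V k * [ k ]` is a discrete antiderivative of the weights. Abel
  -- summation reduces the sum to its last value times `T (suc m)`, and that value carries the
  -- factor `[ suc m ]`.
  ∑-divisible : ∀ a b m (V : ℕ → Carrier) (c e : ℕ → ℤ) →
    (∀ k → V (suc k) * [ suc k ] ≈ V k * [ k ] + qmono (c k) (e k) * [ 2 ℕ.* k ℕ.+ 1 ]) →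
    Σ Carrier λ g →
      ∑ (suc m) (λ k → term (c k ℤ.* σ k ℤ.^ a) (e k ℤ.+ + a ℤ.* + tri k) a b m k) ≈ [ suc m ] * g
  ∑-divisible a b m V c e V-suc = V (suc m) * T (suc m) + proj₁ ∑≡ , (begin
    ∑ (suc m) (λ k → term (c k ℤ.* σ k ℤ.^ a) (e k ℤ.+ + a ℤ.* + tri k) a b m k)
      ≈⟨ ∑-cong (suc m) (λ k → term-regroup (c k) (e k) a b m k) ⟩
    ∑ (suc m) (λ k → w k * T k)                              ≈⟨ proj₂ ∑≡ ⟩
    V (suc m) * [ suc m ] * T (suc m) + [ suc m ] * proj₁ ∑≡ ≈⟨ factor (V (suc m)) [ suc m ] (T (suc m)) _ ⟩
    [ suc m ] * (V (suc m) * T (suc m) + proj₁ ∑≡)           ∎)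
    where
    w T : ℕ → Carrier
    w k = qmono (c k) (e k) * [ 2 ℕ.* k ℕ.+ 1 ]
    T k = X m k ^ a * Y (suc m) k ^ b
    factor = solve 4 (λ v n t g → v :* n :* t :+ n :* g := n :* (v :* t :+ g)) refl
    step : ∀ k → V (suc k) * [ suc k ] * T k ≡[ [ suc m ] ] V (suc k) * [ suc k ] * T (suc k)
    step k = ≡[]-trans (≈⇒≡[] (*-assoc _ _ _))
      (≡[]-trans (≡[]-* (V (suc k)) (scaled-* [ suc k ]
        (scaled-^ [ suc k ] a (X-scaled-step m k)) (scaled-^ [ suc k ] b (Y-scaled-step (suc m) k))))
      (≈⇒≡[] (sym (*-assoc _ _ _))))
    ∑≡ : ∑ (suc m) (λ k → w k * T k) ≡[ [ suc m ] ] V (suc m) * [ suc m ] * T (suc m)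
    ∑≡ = abel-summation (λ k → V k * [ k ]) w T (zeroʳ (V 0)) V-suc step (suc m)

  -- Partial sums of the weights, divided by [ k ]: V₊ serves a' = a and V₋ serves a' = a - 1.
  V₊ V₋ : ℕ → Carrier
  V₊ k = Q (+ 1 - + k) * [ k ]
  V₋ k = qmono (σ (suc k)) (+ 1 - + tri k)

  -- A q-analogue of (k+1)^2 = k^2 + (2k+1). One factor [k+1] is opened as 1 + q[k]; in the
  -- resulting product with q[k], the other is opened as [k] + q^k.
  V₊-suc : ∀ k → V₊ (suc k) * [ suc k ] ≈ V₊ k * [ k ] + Q (ℤ.- + k) * [ 2 ℕ.* k ℕ.+ 1 ]
  V₊-suc k = begin
    Q (+ 1 - + suc k) * [ suc k ] * [ suc k ]
      ≈⟨ *-congʳ (*-congʳ (qmono-cong ≡.refl (e₁ (+ k)))) ⟩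
    u * (1# + q * x) * (1# + q * x)
      ≈⟨ solve 3 (λ u q x → u :* (con 1 :+ q :* x) :* (con 1 :+ q :* x)
                         := u :* (con 1 :+ q :* x) :+ u :* q :* x :* (con 1 :+ q :* x)) refl u q x ⟩
    u * (1# + q * x) + u * q * x * (1# + q * x)
      ≈⟨ +-congˡ (*-congˡ (qint-suc′ k)) ⟩
    u * (1# + q * x) + u * q * x * (x + r)
      ≈⟨ solve 4 (λ u q x r → u :* (con 1 :+ q :* x) :+ u :* q :* x :* (x :+ r)
                           := u :* q :* x :* x :+ u :* (con 1 :+ q :* x :+ (q :* r) :* x)) refl u q x r ⟩
    u * q * x * x + u * ([ suc k ] + q * r * x)
      ≈⟨ +-cong (*-congʳ (*-congʳ (trans (qmono-cong ≡.refl (e₂ (+ k))) (Q-* (ℤ.- + k) (+ 1)))))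
                (*-congˡ (trans (qint-odd k) (+-congˡ (*-congʳ (Q-* (+ 1) (+ k)))))) ⟨
    V₊ k * x + u * [ 2 ℕ.* k ℕ.+ 1 ] ∎
    where
    q = Q (+ 1)
    u = Q (ℤ.- + k)
    x = [ k ]
    r = Q (+ k)
    e₁ : ∀ j → + 1 - (+ 1 ℤ.+ j) ≡ ℤ.- j
    e₁ = solve-∀
    e₂ : ∀ j → + 1 - j ≡ ℤ.- j ℤ.+ + 1
    e₂ = solve-∀

  -- Since [2k+1] = [k+1] + q^(k+1) [k], each alternating weight is itself a difference of
  -- consecutive values. At q = 1 it reads (-1)^k (2k+1) = (-1)^k (k+1) + (-1)^k k.
  V₋-suc : ∀ k → V₋ (suc k) * [ suc k ] ≈
                 V₋ k * [ k ] + qmono (σ k) (ℤ.- + tri k - + k) * [ 2 ℕ.* k ℕ.+ 1 ]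
  V₋-suc k = begin
    V₋ (suc k) * y
      ≈⟨ *-congʳ (qmono-cong (s₁ (σ k)) (≡.trans (cong (λ t → + 1 - + t) (tri-suc k)) (e₁ (+ tri k) (+ k)))) ⟩
    u * y
      ≈⟨ solve 2 (λ u y → u :* y := u :* (con 0 :+ y)) refl u y ⟩
    u * (0# + y)
      ≈⟨ *-congˡ (+-congʳ (trans (*-congʳ (qmono+neg (+ suc k))) (zeroˡ x))) ⟨
    u * ((r + r′) * x + y)
      ≈⟨ solve 5 (λ u r r′ x y → u :* ((r :+ r′) :* x :+ y)
                              := (u :* r′) :* x :+ u :* (y :+ r :* x)) refl u r r′ x y ⟩
    u * r′ * x + u * (y + r * x)
      ≈⟨ +-cong (*-congʳ ur′≈) (*-congˡ (sym (qint-odd k))) ⟩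
    V₋ k * x + u * [ 2 ℕ.* k ℕ.+ 1 ] ∎
    where
    u = qmono (σ k) (ℤ.- + tri k - + k)
    r = Q (+ suc k)
    r′ = qmono -1ℤ (+ suc k)
    x = [ k ]
    y = [ suc k ]
    s₁ : ∀ s → -1ℤ ℤ.* (-1ℤ ℤ.* s) ≡ s
    s₁ = solve-∀
    e₁ : ∀ t j → + 1 - (t ℤ.+ (+ 1 ℤ.+ j)) ≡ ℤ.- t - j
    e₁ = solve-∀
    e₂ : ∀ t j → ℤ.- t - j ℤ.+ (+ 1 ℤ.+ j) ≡ + 1 - t
    e₂ = solve-∀
    ur′≈ : u * r′ ≈ V₋ k
    ur′≈ = trans (qmono-* (σ k) (ℤ.- + tri k - + k) -1ℤ (+ suc k))
      (qmono-cong (ℤ.*-comm (σ k) -1ℤ) (e₂ (+ tri k) (+ k)))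

-- Coefficients of Laurent polynomials and shift operators.

open ≡ using (refl; sym; trans)
open ≡.≡-Reasoning

-- Extension by zero to negative indices makes multiplication by q a plain index shift on all of ℤ.
at : List ℤ → ℤ → ℤ
at xs (+ j)    = lookupL xs j
at xs -[1+ j ] = + 0

-- The unit impulse at 0, the coefficient function of the constant 1.
δ : ℤ → ℤ
δ = at (+ 1 ∷ [])

coeff≡at : ∀ p i → coeff p i ≡ at (cs p) (i - lo p)
coeff≡at p i with i - lo p
... | + j      = refl
... | -[1+ j ] = refl

at-[] : ∀ j → at [] j ≡ + 0
at-[] (+ j)    = refl
at-[] -[1+ j ] = refl

at-∷ : ∀ x xs j → at (x ∷ xs) j ≡ x ℤ.* δ j ℤ.+ at xs (j - + 1)
at-∷ x xs (+ zero)  = sym (trans (ℤ.+-identityʳ _) (ℤ.*-identityʳ x))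
at-∷ x xs (+ suc j) = sym (trans (cong (ℤ._+ lookupL xs j) (ℤ.*-zeroʳ x)) (ℤ.+-identityˡ _))
at-∷ x xs -[1+ j ]  = sym (trans (ℤ.+-identityʳ _) (ℤ.*-zeroʳ x))

lookup-addL : ∀ xs ys j → lookupL (addL xs ys) j ≡ lookupL xs j ℤ.+ lookupL ys j
lookup-addL []       ys       j       = sym (ℤ.+-identityˡ _)
lookup-addL (x ∷ xs) []       j       = sym (ℤ.+-identityʳ _)
lookup-addL (x ∷ xs) (y ∷ ys) zero    = refl
lookup-addL (x ∷ xs) (y ∷ ys) (suc j) = lookup-addL xs ys j

at-addL : ∀ xs ys j → at (addL xs ys) j ≡ at xs j ℤ.+ at ys j
at-addL xs ys (+ j)    = lookup-addL xs ys j
at-addL xs ys -[1+ j ] = refl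

at-map : ∀ x ys j → at (map (x ℤ.*_) ys) j ≡ x ℤ.* at ys j
at-map x []       j = trans (at-[] j) (sym (trans (cong (x ℤ.*_) (at-[] j)) (ℤ.*-zeroʳ x)))
at-map x (y ∷ ys) j = begin
  at (map (x ℤ.*_) (y ∷ ys)) j                       ≡⟨ at-∷ (x ℤ.* y) _ j ⟩
  x ℤ.* y ℤ.* δ j ℤ.+ at (map (x ℤ.*_) ys) (j - + 1) ≡⟨ cong (λ z → x ℤ.* y ℤ.* δ j ℤ.+ z) (at-map x ys (j - + 1)) ⟩
  x ℤ.* y ℤ.* δ j ℤ.+ x ℤ.* at ys (j - + 1)          ≡⟨ factor x y (δ j) _ ⟩
  x ℤ.* (y ℤ.* δ j ℤ.+ at ys (j - + 1))              ≡⟨ cong (x ℤ.*_) (at-∷ y ys j) ⟨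
  x ℤ.* at (y ∷ ys) j                                ∎
  where
  factor : ∀ x y d a → x ℤ.* y ℤ.* d ℤ.+ x ℤ.* a ≡ x ℤ.* (y ℤ.* d ℤ.+ a)
  factor = solve-∀

at-0∷ : ∀ xs j → at (+ 0 ∷ xs) j ≡ at xs (j - + 1)
at-0∷ xs j = trans (at-∷ (+ 0) xs j) (ℤ.+-identityˡ _)

at-padL : ∀ d xs j → at (padL d xs) j ≡ at xs (j - + d)
at-padL zero    xs j = cong (at xs) (sym (ℤ.+-identityʳ j))
at-padL (suc d) xs j = begin
  at (+ 0 ∷ padL d xs) j   ≡⟨ at-0∷ (padL d xs) j ⟩
  at (padL d xs) (j - + 1) ≡⟨ at-padL d xs (j - + 1) ⟩
  at xs (j - + 1 - + d)    ≡⟨ cong (at xs) (shift j (+ d)) ⟩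
  at xs (j - + suc d)      ∎
  where
  shift : ∀ j d → j - + 1 - d ≡ j - (+ 1 ℤ.+ d)
  shift = solve-∀

-- A coefficient list acts on functions ℤ → ℤ as a polynomial in the shift operator; such operators
-- commute, and multiplication of polynomials is their composition.
conv : List ℤ → (ℤ → ℤ) → ℤ → ℤ
conv []       g j = + 0
conv (x ∷ xs) g j = x ℤ.* g j ℤ.+ conv xs g (j - + 1)

conv-cong : ∀ xs {g h} → (∀ j → g j ≡ h j) → ∀ j → conv xs g j ≡ conv xs h j
conv-cong []       g≗h j = refl
conv-cong (x ∷ xs) g≗h j = cong₂ (λ a b → x ℤ.* a ℤ.+ b) (g≗h j) (conv-cong xs g≗h (j - + 1))

conv-zero : ∀ xs j → conv xs (λ _ → + 0) j ≡ + 0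
conv-zero []       j = refl
conv-zero (x ∷ xs) j = cong₂ ℤ._+_ (ℤ.*-zeroʳ x) (conv-zero xs (j - + 1))

conv-+ : ∀ xs g h j → conv xs (λ i → g i ℤ.+ h i) j ≡ conv xs g j ℤ.+ conv xs h j
conv-+ []       g h j = refl
conv-+ (x ∷ xs) g h j = trans (cong (λ z → x ℤ.* (g j ℤ.+ h j) ℤ.+ z) (conv-+ xs g h (j - + 1)))
  (rearrange x (g j) (h j) _ _)
  where
  rearrange : ∀ x a b c d → x ℤ.* (a ℤ.+ b) ℤ.+ (c ℤ.+ d) ≡ x ℤ.* a ℤ.+ c ℤ.+ (x ℤ.* b ℤ.+ d)
  rearrange = solve-∀

conv-* : ∀ xs y g j → conv xs (λ i → y ℤ.* g i) j ≡ y ℤ.* conv xs g j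
conv-* []       y g j = sym (ℤ.*-zeroʳ y)
conv-* (x ∷ xs) y g j = trans (cong (λ z → x ℤ.* (y ℤ.* g j) ℤ.+ z) (conv-* xs y g (j - + 1)))
  (rearrange x y (g j) _)
  where
  rearrange : ∀ x y a b → x ℤ.* (y ℤ.* a) ℤ.+ y ℤ.* b ≡ y ℤ.* (x ℤ.* a ℤ.+ b)
  rearrange = solve-∀

conv-shift : ∀ xs g c j → conv xs (λ i → g (i - c)) j ≡ conv xs g (j - c)
conv-shift []       g c j = refl
conv-shift (x ∷ xs) g c j = cong (λ z → x ℤ.* g (j - c) ℤ.+ z)
  (trans (conv-shift xs g c (j - + 1)) (cong (conv xs g) (swap j c)))
  where
  swap : ∀ j c → j - + 1 - c ≡ j - c - + 1
  swap = solve-∀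

-- Each operator is linear and commutes with the shift, hence with every polynomial in the shift;
-- the induction builds up that polynomial.
conv-comm : ∀ xs ys g j → conv xs (conv ys g) j ≡ conv ys (conv xs g) j
conv-comm []       ys g j = sym (conv-zero ys j)
conv-comm (x ∷ xs) ys g j = begin
  x ℤ.* conv ys g j ℤ.+ conv xs (conv ys g) (j - + 1)
    ≡⟨ cong₂ ℤ._+_ (sym (conv-* ys x g j)) (conv-comm xs ys g (j - + 1)) ⟩
  conv ys (λ i → x ℤ.* g i) j ℤ.+ conv ys (conv xs g) (j - + 1)
    ≡⟨ cong (λ z → conv ys (λ i → x ℤ.* g i) j ℤ.+ z) (conv-shift ys (conv xs g) (+ 1) j) ⟨
  conv ys (λ i → x ℤ.* g i) j ℤ.+ conv ys (λ i → conv xs g (i - + 1)) j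
    ≡⟨ conv-+ ys _ _ j ⟨
  conv ys (conv (x ∷ xs) g) j ∎

at≡conv-δ : ∀ xs j → at xs j ≡ conv xs δ j
at≡conv-δ []       j = at-[] j
at≡conv-δ (x ∷ xs) j = trans (at-∷ x xs j) (cong (λ z → x ℤ.* δ j ℤ.+ z) (at≡conv-δ xs (j - + 1)))

at-mulL : ∀ xs ys j → at (mulL xs ys) j ≡ conv xs (at ys) j
at-mulL []       ys j = at-[] j
at-mulL (x ∷ xs) ys j = begin
  at (addL (map (x ℤ.*_) ys) (+ 0 ∷ mulL xs ys)) j   ≡⟨ at-addL (map (x ℤ.*_) ys) _ j ⟩
  at (map (x ℤ.*_) ys) j ℤ.+ at (+ 0 ∷ mulL xs ys) j ≡⟨ cong₂ ℤ._+_ (at-map x ys j) (at-0∷ (mulL xs ys) j) ⟩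
  x ℤ.* at ys j ℤ.+ at (mulL xs ys) (j - + 1)        ≡⟨ cong (λ z → x ℤ.* at ys j ℤ.+ z) (at-mulL xs ys (j - + 1)) ⟩
  conv (x ∷ xs) (at ys) j                            ∎

-- The operator of a Laurent polynomial: the factor q^(`lo p`) contributes one more shift.
act : Laurent → (ℤ → ℤ) → ℤ → ℤ
act p g i = conv (cs p) g (i - lo p)

act-comm : ∀ p r g i → act p (act r g) i ≡ act r (act p g) i
act-comm p r g i = begin
  conv (cs p) (λ j → conv (cs r) g (j - lo r)) (i - lo p) ≡⟨ conv-shift (cs p) (conv (cs r) g) (lo r) (i - lo p) ⟩
  conv (cs p) (conv (cs r) g) (i - lo p - lo r)           ≡⟨ conv-comm (cs p) (cs r) g _ ⟩
  conv (cs r) (conv (cs p) g) (i - lo p - lo r)           ≡⟨ cong (conv (cs r) (conv (cs p) g)) (swap i (lo p) (lo r)) ⟩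
  conv (cs r) (conv (cs p) g) (i - lo r - lo p)           ≡⟨ conv-shift (cs r) (conv (cs p) g) (lo p) (i - lo r) ⟨
  conv (cs r) (λ j → conv (cs p) g (j - lo p)) (i - lo r) ∎
  where
  swap : ∀ i a b → i - a - b ≡ i - b - a
  swap = solve-∀

-- Applying an operator to the impulse recovers the coefficients, so identities between operators
-- become identities between Laurent polynomials.
coeff-δ : ∀ p i → coeff p i ≡ act p δ i
coeff-δ p i = trans (coeff≡at p i) (at≡conv-δ (cs p) (i - lo p))

coeff-*L : ∀ p r i → coeff (p *L r) i ≡ act p (coeff r) i
coeff-*L p r i = begin
  coeff (p *L r) i                                    ≡⟨ coeff≡at (p *L r) i ⟩
  at (mulL (cs p) (cs r)) (i - (lo p ℤ.+ lo r))       ≡⟨ at-mulL (cs p) (cs r) _ ⟩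
  conv (cs p) (at (cs r)) (i - (lo p ℤ.+ lo r))       ≡⟨ cong (conv (cs p) (at (cs r))) (assoc i (lo p) (lo r)) ⟩
  conv (cs p) (at (cs r)) (i - lo p - lo r)           ≡⟨ conv-shift (cs p) (at (cs r)) (lo r) (i - lo p) ⟨
  conv (cs p) (λ j → at (cs r) (j - lo r)) (i - lo p) ≡⟨ conv-cong (cs p) (λ j → sym (coeff≡at r j)) (i - lo p) ⟩
  act p (coeff r) i                                   ∎
  where
  assoc : ∀ i a b → i - (a ℤ.+ b) ≡ i - a - b
  assoc = solve-∀

coeff-+L : ∀ p r i → coeff (p +L r) i ≡ coeff p i ℤ.+ coeff r i
coeff-+L p r i = begin
  coeff (p +L r) i                                         ≡⟨ coeff≡at (p +L r) i ⟩
  at (addL (padL ℤ.∣ lo p - m ∣ (cs p)) (padL ℤ.∣ lo r - m ∣ (cs r))) (i - m)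
    ≡⟨ at-addL (padL ℤ.∣ lo p - m ∣ (cs p)) _ (i - m) ⟩
  at (padL ℤ.∣ lo p - m ∣ (cs p)) (i - m) ℤ.+ at (padL ℤ.∣ lo r - m ∣ (cs r)) (i - m)
    ≡⟨ cong₂ ℤ._+_ (pad-lo p (ℤ.i⊓j≤i (lo p) (lo r))) (pad-lo r (ℤ.i⊓j≤j (lo p) (lo r))) ⟩
  coeff p i ℤ.+ coeff r i                                  ∎
  where
  m : ℤ
  m = lo p ℤ.⊓ lo r
  cancel : ∀ i l m → i - m - (l - m) ≡ i - l
  cancel = solve-∀
  pad-lo : ∀ s → m ℤ.≤ lo s → at (padL ℤ.∣ lo s - m ∣ (cs s)) (i - m) ≡ coeff s i
  pad-lo s m≤lo = begin
    at (padL ℤ.∣ lo s - m ∣ (cs s)) (i - m) ≡⟨ at-padL _ (cs s) (i - m) ⟩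
    at (cs s) (i - m - + ℤ.∣ lo s - m ∣)    ≡⟨ cong (λ z → at (cs s) (i - m - z)) (ℤ.0≤i⇒+∣i∣≡i (ℤ.i≤j⇒0≤j-i m≤lo)) ⟩
    at (cs s) (i - m - (lo s - m))          ≡⟨ cong (at (cs s)) (cancel i (lo s) m) ⟩
    at (cs s) (i - lo s)                    ≡⟨ coeff≡at s i ⟨
    coeff s i                               ∎

-- Semiring laws for Laurent polynomials.

-- A record rather than a function type, so that p and r can be inferred from p ≈ r.
infix 4 _≈_
record _≈_ (p r : Laurent) : Set where
  constructor ext
  field at-coeff : ∀ i → coeff p i ≡ coeff r i
open _≈_

coeff-zeroL : ∀ i → coeff zeroL i ≡ + 0
coeff-zeroL i = trans (coeff≡at zeroL i) (at-[] (i - + 0))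

act-cong : ∀ p {g h} → (∀ j → g j ≡ h j) → ∀ i → act p g i ≡ act p h i
act-cong p g≗h i = conv-cong (cs p) g≗h (i - lo p)

*L-comm : ∀ p r → p *L r ≈ r *L p
*L-comm p r = ext λ i → begin
  coeff (p *L r) i  ≡⟨ coeff-*L p r i ⟩
  act p (coeff r) i ≡⟨ act-cong p (coeff-δ r) i ⟩
  act p (act r δ) i ≡⟨ act-comm p r δ i ⟩
  act r (act p δ) i ≡⟨ act-cong r (coeff-δ p) i ⟨
  act r (coeff p) i ≡⟨ coeff-*L r p i ⟨
  coeff (r *L p) i  ∎

-- Moving `s` to the front makes `p` and `s` both act on the coefficients of `r`, and these two
-- operators commute.
*L-assoc : ∀ p r s → (p *L r) *L s ≈ p *L (r *L s)
*L-assoc p r s = ext λ i → begin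
  coeff ((p *L r) *L s) i   ≡⟨ at-coeff (*L-comm (p *L r) s) i ⟩
  coeff (s *L (p *L r)) i   ≡⟨ coeff-*L s (p *L r) i ⟩
  act s (coeff (p *L r)) i  ≡⟨ act-cong s (coeff-*L p r) i ⟩
  act s (act p (coeff r)) i ≡⟨ act-comm s p (coeff r) i ⟩
  act p (act s (coeff r)) i ≡⟨ act-cong p (λ j → sym (coeff-*L s r j)) i ⟩
  act p (coeff (s *L r)) i  ≡⟨ act-cong p (at-coeff (*L-comm s r)) i ⟩
  act p (coeff (r *L s)) i  ≡⟨ coeff-*L p (r *L s) i ⟨
  coeff (p *L (r *L s)) i   ∎

*L-congˡ : ∀ p {r s} → r ≈ s → p *L r ≈ p *L s
*L-congˡ p {r} {s} r≈s = ext λ i →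
  trans (coeff-*L p r i) (trans (act-cong p (at-coeff r≈s) i) (sym (coeff-*L p s i)))

≈-trans : ∀ {p r s} → p ≈ r → r ≈ s → p ≈ s
≈-trans e f = ext λ i → trans (at-coeff e i) (at-coeff f i)

coeff-oneL* : ∀ p i → coeff (oneL *L p) i ≡ coeff p i
coeff-oneL* p i = begin
  coeff (oneL *L p) i               ≡⟨ coeff-*L oneL p i ⟩
  + 1 ℤ.* coeff p (i - + 0) ℤ.+ + 0 ≡⟨ ℤ.+-identityʳ _ ⟩
  + 1 ℤ.* coeff p (i - + 0)         ≡⟨ ℤ.*-identityˡ _ ⟩
  coeff p (i - + 0)                 ≡⟨ cong (coeff p) (ℤ.+-identityʳ i) ⟩
  coeff p i                         ∎

laurentSemiring : CommutativeSemiring _ _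
laurentSemiring = record
  { Carrier = Laurent
  ; _≈_     = _≈_
  ; _+_     = _+L_
  ; _*_     = _*L_
  ; 0#      = zeroL
  ; 1#      = oneL
  ; isCommutativeSemiring = isCommutativeSemiringʳ record
    { +-isCommutativeMonoid = record
      { isMonoid = record
        { isSemigroup = record
          { isMagma = record
            { isEquivalence = isEquivalence-≈
            ; ∙-cong = λ {p} {p′} {r} {r′} e f → ext λ i →
                trans (coeff-+L p r i) (trans (cong₂ ℤ._+_ (at-coeff e i) (at-coeff f i)) (sym (coeff-+L p′ r′ i)))
            }
          ; assoc = λ p r s → ext λ i → begin
              coeff (p +L r +L s) i                   ≡⟨ coeff-+L (p +L r) s i ⟩
              coeff (p +L r) i ℤ.+ coeff s i          ≡⟨ cong (ℤ._+ coeff s i) (coeff-+L p r i) ⟩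
              coeff p i ℤ.+ coeff r i ℤ.+ coeff s i   ≡⟨ ℤ.+-assoc (coeff p i) _ _ ⟩
              coeff p i ℤ.+ (coeff r i ℤ.+ coeff s i) ≡⟨ cong (λ z → coeff p i ℤ.+ z) (coeff-+L r s i) ⟨
              coeff p i ℤ.+ coeff (r +L s) i          ≡⟨ coeff-+L p (r +L s) i ⟨
              coeff (p +L (r +L s)) i                 ∎
          }
        ; identity = (λ p → ≈-trans (+L-comm zeroL p) (+L-identityʳ p)) , +L-identityʳ
        }
      ; comm = +L-comm
      }
    ; *-isCommutativeMonoid = record
      { isMonoid = record
        { isSemigroup = record
          { isMagma = record
            { isEquivalence = isEquivalence-≈
            ; ∙-cong = λ {p} {p′} {r} {r′} e f → ≈-trans (*L-congˡ p f)
                (≈-trans (*L-comm p r′) (≈-trans (*L-congˡ r′ e) (*L-comm r′ p′)))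
            }
          ; assoc = *L-assoc
          }
        ; identity = (λ p → ext (coeff-oneL* p)) , λ p → ≈-trans (*L-comm p oneL) (ext (coeff-oneL* p))
        }
      ; comm = *L-comm
      }
    ; distribˡ = λ p r s → ext λ i → begin
        coeff (p *L (r +L s)) i                 ≡⟨ coeff-*L p (r +L s) i ⟩
        act p (coeff (r +L s)) i                ≡⟨ act-cong p (coeff-+L r s) i ⟩
        act p (λ j → coeff r j ℤ.+ coeff s j) i ≡⟨ conv-+ (cs p) (coeff r) (coeff s) (i - lo p) ⟩
        act p (coeff r) i ℤ.+ act p (coeff s) i ≡⟨ cong₂ ℤ._+_ (coeff-*L p r i) (coeff-*L p s i) ⟨
        coeff (p *L r) i ℤ.+ coeff (p *L s) i   ≡⟨ coeff-+L (p *L r) (p *L s) i ⟨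
        coeff (p *L r +L p *L s) i              ∎
    ; zeroʳ = λ p → ext λ i → begin
        coeff (p *L zeroL) i  ≡⟨ coeff-*L p zeroL i ⟩
        act p (coeff zeroL) i ≡⟨ act-cong p coeff-zeroL i ⟩
        act p (λ _ → + 0) i   ≡⟨ conv-zero (cs p) (i - lo p) ⟩
        + 0                   ≡⟨ coeff-zeroL i ⟨
        coeff zeroL i         ∎
    }
  }
  where
  isEquivalence-≈ : IsEquivalence _≈_
  isEquivalence-≈ = record
    { refl  = ext λ _ → refl
    ; sym   = λ e → ext λ i → sym (at-coeff e i)
    ; trans = ≈-trans
    }
  +L-comm : ∀ p r → p +L r ≈ r +L p
  +L-comm p r = ext λ i →
    trans (coeff-+L p r i) (trans (ℤ.+-comm (coeff p i) _) (sym (coeff-+L r p i)))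
  +L-identityʳ : ∀ p → p +L zeroL ≈ p
  +L-identityʳ p = ext λ i →
    trans (coeff-+L p zeroL i) (trans (cong (λ z → coeff p i ℤ.+ z) (coeff-zeroL i)) (ℤ.+-identityʳ _))

coeff-mono : ∀ c e i → coeff (mono c e) i ≡ c ℤ.* δ (i - e)
coeff-mono c e i = begin
  coeff (mono c e) i                      ≡⟨ coeff≡at (mono c e) i ⟩
  at (c ∷ []) (i - e)                     ≡⟨ at-∷ c [] (i - e) ⟩
  c ℤ.* δ (i - e) ℤ.+ at [] (i - e - + 1) ≡⟨ cong (λ z → c ℤ.* δ (i - e) ℤ.+ z) (at-[] (i - e - + 1)) ⟩
  c ℤ.* δ (i - e) ℤ.+ + 0                 ≡⟨ ℤ.+-identityʳ _ ⟩
  c ℤ.* δ (i - e)                         ∎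

-- The two instances: Laurent polynomials and the integers.

laurentMonomials : QMonomials laurentSemiring
laurentMonomials = record
  { qmono     = mono
  ; qmono-1   = ext λ _ → refl
  -- `mulL` of two singletons computes to the one coefficient `c ℤ.* d ℤ.+ + 0`.
  ; qmono-*   = λ c e d f → ext λ i → cong (λ z → coeff (mono z (e ℤ.+ f)) i) (ℤ.+-identityʳ (c ℤ.* d))
  ; qmono+neg = λ e → ext λ i → begin
      coeff (mono (+ 1) e +L mono -1ℤ e) i            ≡⟨ coeff-+L (mono (+ 1) e) (mono -1ℤ e) i ⟩
      coeff (mono (+ 1) e) i ℤ.+ coeff (mono -1ℤ e) i ≡⟨ cong₂ ℤ._+_ (coeff-mono (+ 1) e i) (coeff-mono -1ℤ e i) ⟩
      + 1 ℤ.* δ (i - e) ℤ.+ -1ℤ ℤ.* δ (i - e)         ≡⟨ cancel (δ (i - e)) ⟩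
      + 0                                             ≡⟨ coeff-zeroL i ⟨
      coeff zeroL i                                   ∎
  }
  where
  cancel : ∀ x → + 1 ℤ.* x ℤ.+ -1ℤ ℤ.* x ≡ + 0
  cancel = solve-∀

ℤ-semiring : CommutativeSemiring _ _
ℤ-semiring = CommutativeRing.commutativeSemiring ℤ.+-*-commutativeRing

-- The specialisation q = 1.
ℤ-monomials : QMonomials ℤ-semiring
ℤ-monomials = record
  { qmono     = λ c _ → c
  ; qmono-1   = refl
  ; qmono-*   = λ _ _ _ _ → refl
  ; qmono+neg = λ _ → refl
  }

module L where
  open QSums laurentSemiring laurentMonomials public
  open CommutativeSemiring laurentSemiring public using (+-cong; *-cong) renaming (refl to ≈-refl; sym to ≈-sym)

module Z = QSums ℤ-semiring ℤ-monomials

-- Transfer to the concrete q-sum.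

*L-cong : ∀ {p p′ r r′} → p ≈ p′ → r ≈ r′ → p *L r ≈ p′ *L r′
*L-cong = L.*-cong

-- A list of ones is a leading 1 followed by a shifted list of ones; this links the list encoding to
-- the recursion for `L.[_]`.
qint-suc : ∀ m → qint (suc m) ≈ oneL +L mono (+ 1) (+ 1) *L qint m
qint-suc m = ext λ i → begin
  coeff (qint (suc m)) i                                   ≡⟨ coeff≡at (qint (suc m)) i ⟩
  at (cs (qint (suc m))) (i - + 0)                         ≡⟨ at-∷ (+ 1) (cs (qint m)) (i - + 0) ⟩
  + 1 ℤ.* δ (i - + 0) ℤ.+ at (cs (qint m)) (i - + 0 - + 1) ≡⟨ cong₂ ℤ._+_ (sym (coeff-mono (+ 1) (+ 0) i)) (shift i) ⟩
  coeff oneL i ℤ.+ coeff (mono (+ 1) (+ 1) *L qint m) i    ≡⟨ coeff-+L oneL _ i ⟨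
  coeff (oneL +L mono (+ 1) (+ 1) *L qint m) i             ∎
  where
  swap : ∀ i → i - + 0 - + 1 ≡ i - + 1 - + 0
  swap = solve-∀
  shift : ∀ i → at (cs (qint m)) (i - + 0 - + 1) ≡ coeff (mono (+ 1) (+ 1) *L qint m) i
  shift i = begin
    at (cs (qint m)) (i - + 0 - + 1)         ≡⟨ cong (at (cs (qint m))) (swap i) ⟩
    at (cs (qint m)) (i - + 1 - + 0)         ≡⟨ coeff≡at (qint m) (i - + 1) ⟨
    coeff (qint m) (i - + 1)                 ≡⟨ ℤ.*-identityˡ _ ⟨
    + 1 ℤ.* coeff (qint m) (i - + 1)         ≡⟨ ℤ.+-identityʳ _ ⟨
    + 1 ℤ.* coeff (qint m) (i - + 1) ℤ.+ + 0 ≡⟨ coeff-*L (mono (+ 1) (+ 1)) (qint m) i ⟨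
    coeff (mono (+ 1) (+ 1) *L qint m) i     ∎

qint≈ : ∀ m → qint m ≈ L.[_] m
qint≈ zero    = L.≈-refl
qint≈ (suc m) = ≈-trans (qint-suc m) (L.+-cong {oneL} L.≈-refl (*L-congˡ q (qint≈ m)))
  where
  q : Laurent
  q = mono (+ 1) (+ 1)

qbinom≈ : ∀ m k → qbinom m k ≈ L.[_choose_] m k
qbinom≈ m       zero    = L.≈-refl
qbinom≈ zero    (suc k) = L.≈-refl
qbinom≈ (suc m) (suc k) = L.+-cong (qbinom≈ m k) (*L-congˡ (mono (+ 1) (+ suc k)) (qbinom≈ m (suc k)))

^L≈ : ∀ {p r} a → p ≈ r → p ^L a ≈ r L.^ a
^L≈ zero    p≈r = L.≈-refl
^L≈ (suc a) p≈r = L.*-cong p≈r (^L≈ a p≈r)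

sumL≈ : ∀ n {f g} → (∀ k → f k ≈ g k) → sumL n f ≈ L.∑ n g
sumL≈ zero    f≈g = L.≈-refl
sumL≈ (suc n) f≈g = L.+-cong (sumL≈ n f≈g) (f≈g n)

-- The last two hypotheses split the sign and the exponent of the summand into those of the weight
-- and those of X_k^a.
qsum-divisible : ∀ a b m a′ (V : ℕ → Laurent) (c e : ℕ → ℤ) →
  (∀ k → V (suc k) *L L.[_] (suc k) ≈ V k *L L.[_] k +L mono (c k) (e k) *L L.[_] (2 ℕ.* k ℕ.+ 1)) →
  (∀ k → -1ℤ ℤ.^ (ℤ.∣ a′ ∣ ℕ.* k) ≡ c k ℤ.* L.σ k ℤ.^ a) →
  (∀ k → a′ ℤ.* + tri k - + k ≡ e k ℤ.+ + a ℤ.* + tri k) →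
  qint (suc m) ∣L qsum a′ a b (suc m)
qsum-divisible a b m a′ V c e V-suc sign exponent = proj₁ divisible , at-coeff sum≈
  where
  n : ℕ
  n = suc m
  t : ℕ → Laurent
  t k = L.term (c k ℤ.* L.σ k ℤ.^ a) (e k ℤ.+ + a ℤ.* + tri k) a b m k
  divisible : Σ Laurent λ g → L.∑ n t ≈ L.[_] n *L g
  divisible = L.∑-divisible a b m V c e V-suc
  g : Laurent
  g = proj₁ divisible
  term≈ : ∀ k → qterm a′ a b n k ≈ t k
  term≈ k = *L-cong {p = u *L o *L x} {r = y} (*L-cong {p = u *L o} {r = x}
      (*L-cong {p = u} {r = o} (L.qmono-cong (sign k) (exponent k)) (qint≈ (2 ℕ.* k ℕ.+ 1)))
      (^L≈ a (qbinom≈ m k))) (^L≈ b (qbinom≈ (n ℕ.+ k) k))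
    where
    u o x y : Laurent
    u = mono (-1ℤ ℤ.^ (ℤ.∣ a′ ∣ ℕ.* k)) (a′ ℤ.* + tri k - + k)
    o = qint (2 ℕ.* k ℕ.+ 1)
    x = qbinom m k ^L a
    y = qbinom (n ℕ.+ k) k ^L b
  sum≈ : qsum a′ a b n ≈ qint n *L g
  sum≈ = ≈-trans {qsum a′ a b n} {L.∑ n t} {qint n *L g} (sumL≈ n {qterm a′ a b n} {t} term≈)
    (≈-trans {L.∑ n t} {L.[_] n *L g} {qint n *L g} (proj₂ divisible)
      (*L-cong {p = L.[_] n} {p′ = qint n} {r = g} {r′ = g} (L.≈-sym (qint≈ n)) L.≈-refl))

-- Transfer to the integer sum at q = 1.

[]≡+ : ∀ m → Z.[_] m ≡ + m
[]≡+ zero    = refl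
[]≡+ (suc m) = cong (λ z → + 1 ℤ.+ z) (trans (ℤ.*-identityˡ _) ([]≡+ m))

choose≡C : ∀ m k → Z.[_choose_] m k ≡ + (m C k)
choose≡C m       zero    = refl
choose≡C zero    (suc k) = cong +_ (sym (k>n⇒nCk≡0 (ℕ.s≤s (ℕ.z≤n {k}))))
choose≡C (suc m) (suc k) = begin
  Z.[_choose_] m k ℤ.+ + 1 ℤ.* Z.[_choose_] m (suc k)
    ≡⟨ cong₂ ℤ._+_ (choose≡C m k) (trans (ℤ.*-identityˡ _) (choose≡C m (suc k))) ⟩
  + (m C k) ℤ.+ + (m C suc k) ≡⟨ ℤ.pos-+ (m C k) (m C suc k) ⟨
  + (m C k ℕ.+ m C suc k)     ≡⟨ cong +_ (nCk+nC[k+1]≡[n+1]C[k+1] m k) ⟩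
  + (suc m C suc k)           ∎

pos-^ : ∀ x a → + (x ℕ.^ a) ≡ (+ x) Z.^ a
pos-^ x zero    = refl
pos-^ x (suc a) = trans (ℤ.pos-* x (x ℕ.^ a)) (cong (λ z → + x ℤ.* z) (pos-^ x a))

sumℤ≡ : ∀ n {f g} → (∀ k → f k ≡ g k) → sumℤ n f ≡ Z.∑ n g
sumℤ≡ zero    f≡g = refl
sumℤ≡ (suc n) f≡g = cong₂ ℤ._+_ (sumℤ≡ n f≡g) (f≡g n)

isum-divisible : ∀ a b m s (V : ℕ → ℤ) (c e : ℕ → ℤ) →
  (∀ k → V (suc k) ℤ.* Z.[_] (suc k) ≡ V k ℤ.* Z.[_] k ℤ.+ c k ℤ.* Z.[_] (2 ℕ.* k ℕ.+ 1)) →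
  (∀ k → s ℤ.^ k ≡ c k ℤ.* Z.σ k ℤ.^ a) →
  + suc m ∣ isum s a b (suc m)
isum-divisible a b m s V c e V-suc sign = ∣⇒∣ᵤ (divides g (begin
  isum s a b (suc m)  ≡⟨ sumℤ≡ (suc m) term≡ ⟩
  Z.∑ (suc m) _       ≡⟨ proj₂ divisible ⟩
  Z.[_] (suc m) ℤ.* g ≡⟨ ℤ.*-comm _ g ⟩
  g ℤ.* Z.[_] (suc m) ≡⟨ cong (g ℤ.*_) ([]≡+ (suc m)) ⟩
  g ℤ.* + suc m       ∎))
  where
  divisible = Z.∑-divisible a b m V c e V-suc
  g = proj₁ divisible
  power : ∀ n k x → + ((n C k) ℕ.^ x) ≡ Z.[_choose_] n k Z.^ x
  power n k x = trans (pos-^ (n C k) x) (cong (Z._^ x) (sym (choose≡C n k)))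
  term≡ : ∀ k → s ℤ.^ k ℤ.* + (2 ℕ.* k ℕ.+ 1) ℤ.* + ((m C k) ℕ.^ a) ℤ.* + (((suc m ℕ.+ k) C k) ℕ.^ b)
                ≡ Z.term (c k ℤ.* Z.σ k ℤ.^ a) (e k ℤ.+ + a ℤ.* + tri k) a b m k
  term≡ k = cong₂ ℤ._*_ (cong₂ ℤ._*_ (cong₂ ℤ._*_ (sign k) (sym ([]≡+ _))) (power m k a)) (power (suc m ℕ.+ k) k b)

-- Sign bookkeeping and conclusion.

σ-square : ∀ k → L.σ k ℤ.* L.σ k ≡ + 1
σ-square zero    = refl
σ-square (suc k) = trans (square-neg (L.σ k)) (σ-square k)
  where
  square-neg : ∀ s → -1ℤ ℤ.* s ℤ.* (-1ℤ ℤ.* s) ≡ s ℤ.* s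
  square-neg = solve-∀

σ-^ : ∀ k a → L.σ k ℤ.^ a ≡ -1ℤ ℤ.^ (a ℕ.* k)
σ-^ k a = trans (ℤ.^-*-assoc -1ℤ k a) (cong (-1ℤ ℤ.^_) (ℕ.*-comm k a))

sign₊ : ∀ a k → -1ℤ ℤ.^ (ℤ.∣ + a ∣ ℕ.* k) ≡ + 1 ℤ.* L.σ k ℤ.^ a
sign₊ a k = sym (trans (ℤ.*-identityˡ _) (σ-^ k a))

sign₋ : ∀ a k → -1ℤ ℤ.^ (ℤ.∣ + a - + 1 ∣ ℕ.* k) ≡ L.σ k ℤ.* L.σ k ℤ.^ a
-- For a = 0 the multiplier a' is -1, of absolute value 1, so the sign is `L.σ k` itself.
sign₋ zero    k = trans (cong (-1ℤ ℤ.^_) (ℕ.+-identityʳ k)) (sym (ℤ.*-identityʳ _))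
sign₋ (suc a) k = begin
  -1ℤ ℤ.^ (a ℕ.* k)                 ≡⟨ σ-^ k a ⟨
  L.σ k ℤ.^ a                       ≡⟨ ℤ.*-identityˡ _ ⟨
  + 1 ℤ.* L.σ k ℤ.^ a               ≡⟨ cong (ℤ._* (L.σ k ℤ.^ a)) (σ-square k) ⟨
  L.σ k ℤ.* L.σ k ℤ.* L.σ k ℤ.^ a   ≡⟨ ℤ.*-assoc (L.σ k) (L.σ k) _ ⟩
  L.σ k ℤ.* (L.σ k ℤ.* L.σ k ℤ.^ a) ∎

σ-parity : ∀ a → L.σ a ≡ + 1 ⊎ L.σ a ≡ -1ℤ
σ-parity zero    = inj₁ refl
σ-parity (suc a) with σ-parity a
... | inj₁ eq = inj₂ (cong (-1ℤ ℤ.*_) eq)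
... | inj₂ eq = inj₁ (cong (-1ℤ ℤ.*_) eq)

-- The sign (-1)^(ak) equals s^k when (-1)^a = s, and otherwise one more factor (-1)^k corrects it.
-- So each s is served by one of the two families of weights.
sign-choice : ∀ a s → s ≡ + 1 ⊎ s ≡ -1ℤ →
  (∀ k → s ℤ.^ k ≡ + 1 ℤ.* L.σ k ℤ.^ a) ⊎ (∀ k → s ℤ.^ k ≡ L.σ k ℤ.* L.σ k ℤ.^ a)
sign-choice a s s≡ = choose (σ-parity a) s≡
  where
  power : ∀ k {t} → L.σ a ≡ t → L.σ k ℤ.^ a ≡ t ℤ.^ k
  power k eq = trans (σ-^ k a) (trans (sym (ℤ.^-*-assoc -1ℤ a k)) (cong (ℤ._^ k) eq))
  same : ∀ {s} → L.σ a ≡ s → ∀ k → s ℤ.^ k ≡ + 1 ℤ.* L.σ k ℤ.^ a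
  same eq k = sym (trans (ℤ.*-identityˡ _) (power k eq))
  choose : ∀ {s} → L.σ a ≡ + 1 ⊎ L.σ a ≡ -1ℤ → s ≡ + 1 ⊎ s ≡ -1ℤ →
    (∀ k → s ℤ.^ k ≡ + 1 ℤ.* L.σ k ℤ.^ a) ⊎ (∀ k → s ℤ.^ k ≡ L.σ k ℤ.* L.σ k ℤ.^ a)
  choose (inj₁ eq) (inj₁ refl) = inj₁ (same eq)
  choose (inj₂ eq) (inj₂ refl) = inj₁ (same eq)
  choose (inj₁ eq) (inj₂ refl) = inj₂ λ k →
    sym (trans (cong (L.σ k ℤ.*_) (trans (power k eq) (ℤ.^-zeroˡ k))) (ℤ.*-identityʳ _))
  choose (inj₂ eq) (inj₁ refl) = inj₂ λ k →
    trans (ℤ.^-zeroˡ k) (sym (trans (cong (L.σ k ℤ.*_) (power k eq)) (σ-square k)))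

theorem3p2 : (a b n : ℕ) → 1 ≤ n →
    ((a' : ℤ) → (a' ≡ + a ⊎ a' ≡ + a - + 1) → qint n ∣L qsum a' a b n)
    × ((s : ℤ) → (s ≡ + 1 ⊎ s ≡ -1ℤ) → (+ n) ∣ isum s a b n)
theorem3p2 a b (suc m) _ = q-part , ℤ-part
  where
  e₊ e₋ : ℕ → ℤ
  e₊ k = ℤ.- + k
  e₋ k = ℤ.- + tri k - + k
  exponent₊ : ∀ a t k → a ℤ.* t - k ≡ ℤ.- k ℤ.+ a ℤ.* t
  exponent₊ = solve-∀
  exponent₋ : ∀ a t k → (a - + 1) ℤ.* t - k ≡ ℤ.- t - k ℤ.+ a ℤ.* t
  exponent₋ = solve-∀
  q-part : (a' : ℤ) → (a' ≡ + a ⊎ a' ≡ + a - + 1) → qint (suc m) ∣L qsum a' a b (suc m)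
  q-part a' (inj₁ refl) = qsum-divisible a b m a' L.V₊ (λ _ → + 1) e₊ L.V₊-suc
    (sign₊ a) (λ k → exponent₊ (+ a) (+ tri k) (+ k))
  q-part a' (inj₂ refl) = qsum-divisible a b m a' L.V₋ L.σ e₋ L.V₋-suc
    (sign₋ a) (λ k → exponent₋ (+ a) (+ tri k) (+ k))
  ℤ-part : (s : ℤ) → (s ≡ + 1 ⊎ s ≡ -1ℤ) → (+ suc m) ∣ isum s a b (suc m)
  ℤ-part s s≡ with sign-choice a s s≡
  ... | inj₁ sign = isum-divisible a b m s Z.V₊ (λ _ → + 1) e₊ Z.V₊-suc sign
  ... | inj₂ sign = isum-divisible a b m s Z.V₋ L.σ e₋ Z.V₋-suc sign
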